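{- Let $\phi$ be an unsatisfiable $\mathcal{T}$-formula, and let $Q$ be a non-interfering set of critical assignments for $\phi$. Then every Fixed-Alphabet-DPLL($\mathcal{T}$) proof that $\phi$ is unsatisfiable contains at least $|Q|$ applications of the rule $\mathcal{T}$-learn.
   Context: Propositional notions. Fix a set $\mathcal{X}$ of propositional variables. A literal is $v$ or $\lnot v$ with $v\in\mathcal{X}$; $\lnot\lnot v$ is identified with $v$. A clause is a (finite) set of literals, interpreted as their disjunction; the empty clause $\Box$ denotes false. A partial assignment is a set of literals not containing both a variable and its negation, interpreted as a conjunction. An assignment $M$ is a partial assignment such that for every $v \in \mathcal{X}$ either $v\in M$ or $\lnot v \in M$. For a set $C$ of literals, $\lnot C = \{\lnot \ell \mid \ell \in C\}$; if $C$ is a clause, $\lnot C$ is interpreted as a conjunction. Theory notions. $\mathcal{T}$ is a first-order theory. $\phi$ is a $\mathcal{T}$-formula in CNF, with (finite) set of $\mathcal{T}$-atoms $\mathcal{A}$, and $(\cdot)^{\mathbb{B}}:\mathcal{A}\to\mathcal{X}$ is an injective map (propositional abstraction). $\mathcal{L}_{\mathcal{A}}$ is the set of literals over $\mathcal{A}$; $(\cdot)^{\mathbb{B}}$ is lifted to $\mathcal{T}$-literals (by $(\lnot a)^{\mathbb{B}}=\lnot a^{\mathbb{B}}$) and to sets of $\mathcal{T}$-literals. The formula $\phi$ is represented by finitely many clauses $C_1,\dots,C_\alpha$ over $\mathcal{X}$ (its propositional abstraction), together with $\mathcal{A}$ and $(\cdot)^{\mathbb{B}}$. A $\mathcal{T}$-conflict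 is a set of literals in $\mathcal{L}_{\mathcal{A}}$ whose conjunction is $\mathcal{T}$-unsatisfiable; it is written $\lnot L$, where $L\subseteq\mathcal{L}_{\mathcal{A}}$ is the corresponding $\mathcal{T}$-valid clause ($\models_{\mathcal{T}}\bigvee_{t\in L}t$). A $\mathcal{T}$-conflict is minimal if every strict subset of it is $\mathcal{T}$-satisfiable. $\lnot L^{\mathbb{B}}$ denotes the abstraction of $\lnot L$, i.e. $\{\lnot \ell\mid \ell\in L^{\mathbb{B}}\}$. Proofs. A Fixed-Alphabet-DPLL($\mathcal{T}$) proof that $\phi$ is unsatisfiable is a finite sequence of clauses $C_1,\dots,C_\alpha,\dots,C_k,\dots,C_\beta=\Box$, where each $C_k$ with $\alpha<k\le\beta$ is derived by one of two rules: (Res) $C_k$ is the propositional resolvent $(C_i\setminus\{\ell\})\cup(C_j\setminus\{\lnot\ell\})$ of two earlier clauses $C_i, C_j$ with $i\ne j$, $i,j<k$, $\ell\in C_i$, $\lnot\ell\in C_j$; ($\mathcal{T}$-learn) $C_k=L^{\mathbb{B}}$ for some $L\subseteq\mathcal{L}_{\mathcal{A}}$ with $\models_{\mathcal{T}}\bigvee_{t\in L}t$. The number of applications of $\mathcal{T}$-learn is the number of indices $k\in(\alpha,\beta]$ whose clause is derived by $\mathcal{T}$-learn. Critical assignments. An assignment $M$ is critical for $\phi$ if $M\models\bigwedge_{i=1}^{\alpha}C_i$ and there is exactly one minimal $\mathcal{T}$-conflict $\lnot L$ with $\lnot L^{\mathbb{B}}\subseteq M$. For a set $Q=\{M_1,\dots,M_{|Q|}\}$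 of critical assignments for $\phi$, let $\lnot L_i$ be the minimal $\mathcal{T}$-conflict of $M_i$. $Q$ is non-interfering if for all $M_i\ne M_j$ in $Q$, $\lnot L_i^{\mathbb{B}}$ is not a subset of $M_j$. -}

module Defs where

open import Data.Empty using (⊥)
open import Data.Fin using (Fin)
open import Data.List using (List; []; _∷_; map; foldr; reverse; length; lookup)
open import Data.List.Membership.Propositional using (_∈_)
open import Data.List.Relation.Binary.BagAndSetEquality using (_∼[_]_; set)
open import Data.List.Relation.Binary.Subset.Propositional using (_⊆_)
open import Data.List.Relation.Unary.All using (All)
open import Data.List.Relation.Unary.Any using (Any)
open import Data.Nat using (ℕ; zero; suc)
open import Data.Product using (∃-syntax; _×_)
open import Data.Sum using (_⊎_)
open import Data.Vec using (Vec; []; _∷_)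
import Data.Vec as Vec
open import Function using (_⇔_; Injective)
open import Level using (0ℓ)
open import Relation.Binary.PropositionalEquality using (_≡_; _≢_)
open import Relation.Nullary using (¬_)
open import Relation.Nullary.Negation using (Stable)
open import Relation.Unary using (Pred; _≐_)

------------------------------------------------------------------------
-- Literals, clauses, assignments

data Literal (V : Set) : Set where
  pos neg : V → Literal V

~_ : ∀ {V} → Literal V → Literal V
~ pos v = neg v
~ neg v = pos v

-- Finite sets are lists up to `_∼[ set ]_`: nothing below depends on the
-- order or the multiplicity of the literals in a list.

Clause : Set → Set
Clause V = List (Literal V)

□ : ∀ {V} → Clause V
□ = []

record Assignment (X : Set) : Set₁ where
  field
    literals   : Pred (Literal X) 0ℓ
    consistent : ∀ v → ¬ (literals (pos v) × literals (neg v))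
    total      : ∀ v → literals (pos v) ⊎ literals (neg v)

open Assignment public

infix 4 _≋_ _⊨ᶜ_ _⊑_

_≋_ : ∀ {X} → Assignment X → Assignment X → Set
M ≋ N = literals M ≐ literals N

_⊨ᶜ_ : ∀ {X} → Assignment X → Clause X → Set
M ⊨ᶜ C = Any (literals M) C

_⊑_ : ∀ {X} → List (Literal X) → Assignment X → Set
K ⊑ M = All (literals M) K

------------------------------------------------------------------------
-- First-order logic with equality

record Signature : Set₁ where
  field
    Fun      : Set
    Rel      : Set
    funArity : Fun → ℕ
    relArity : Rel → ℕ

open Signature public

-- The index n bounds the free (de Bruijn) variables.

data Term (S : Signature) (n : ℕ) : Set where
  var : Fin n → Term S n
  app : (f : Fun S) → Vec (Term S n) (funArity S f) → Term S n

data Atom (S : Signature) (n : ℕ) : Set where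
  rel  : (r : Rel S) → Vec (Term S n) (relArity S r) → Atom S n
  _≈_ : Term S n → Term S n → Atom S n

infixr 5 _⇒_

data Formula (S : Signature) (n : ℕ) : Set where
  atom : Atom S n → Formula S n
  ⊥′   : Formula S n
  _⇒_  : Formula S n → Formula S n → Formula S n
  ∀′   : Formula S (suc n) → Formula S n

module _ {S : Signature} {n : ℕ} where

  infixr 6 _∨_
  infixr 7 _∧_

  ¬′_ : Formula S n → Formula S n
  ¬′ A = A ⇒ ⊥′

  ⊤′ : Formula S n
  ⊤′ = ¬′ ⊥′

  _∨_ _∧_ : Formula S n → Formula S n → Formula S n
  A ∨ B = (¬′ A) ⇒ B
  A ∧ B = ¬′ (A ⇒ (¬′ B))

  ⋁ ⋀ : List (Formula S n) → Formula S n
  ⋁ = foldr _∨_ ⊥′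
  ⋀ = foldr _∧_ ⊤′

-- Logic is classical: relations and equality are ¬¬-stable, hence so is
-- the truth value of every formula (⊥′, ⇒, ∀′ preserve stability), and
-- the defined connectives have their classical meaning.  Under excluded
-- middle the two stability fields hold automatically.

record Structure (S : Signature) : Set₁ where
  field
    Domain     : Set
    inhabitant : Domain
    ⟦fun⟧      : (f : Fun S) → Vec Domain (funArity S f) → Domain
    ⟦rel⟧      : (r : Rel S) → Vec Domain (relArity S r) → Set
    rel-stable : ∀ r ds → Stable (⟦rel⟧ r ds)
    ≡-stable   : ∀ (d e : Domain) → Stable (d ≡ e)

open Structure public

module _ {S : Signature} (𝔐 : Structure S) where

  Valuation : ℕ → Set
  Valuation n = Vec (Domain 𝔐) n

  mutual
    eval : ∀ {n} → Valuation n → Term S n → Domain 𝔐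
    eval ρ (var i)    = Vec.lookup ρ i
    eval ρ (app f ts) = ⟦fun⟧ 𝔐 f (evals ρ ts)

    evals : ∀ {n k} → Valuation n → Vec (Term S n) k → Vec (Domain 𝔐) k
    evals ρ []       = []
    evals ρ (t ∷ ts) = eval ρ t ∷ evals ρ ts

  ⟦_⟧ᵃ : ∀ {n} → Atom S n → Valuation n → Set
  ⟦ rel r ts ⟧ᵃ ρ = ⟦rel⟧ 𝔐 r (evals ρ ts)
  ⟦ s ≈ t ⟧ᵃ    ρ = eval ρ s ≡ eval ρ t

  Holds : ∀ {n} → Formula S n → Valuation n → Set
  Holds (atom a) ρ = ⟦ a ⟧ᵃ ρ
  Holds ⊥′       ρ = ⊥
  Holds (A ⇒ B)  ρ = Holds A ρ → Holds B ρ
  Holds (∀′ A)   ρ = ∀ d → Holds A (d ∷ ρ)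

Theory : Signature → Set₁
Theory S = Pred (Formula S 0) 0ℓ

Model : ∀ {S} → Theory S → Structure S → Set
Model 𝒯 𝔐 = ∀ A → 𝒯 A → Holds 𝔐 A []

-- Free variables are read existentially for satisfiability and
-- universally for validity, i.e. as uninterpreted constants.

module _ {S : Signature} (𝒯 : Theory S) {n : ℕ} where

  Satisfiable Unsatisfiable Valid : Formula S n → Set₁
  Satisfiable A   = ∃[ 𝔐 ] (Model 𝒯 𝔐 × ∃[ ρ ] Holds 𝔐 A ρ)
  Unsatisfiable A = ¬ Satisfiable A
  Valid A         = ∀ 𝔐 → Model 𝒯 𝔐 → ∀ ρ → Holds 𝔐 A ρ

------------------------------------------------------------------------
-- Formulas in CNF, with their set of atoms 𝒜 = {atomAt 0, …, atomAt (∣𝒜∣-1)}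

record CNF (S : Signature) (n : ℕ) : Set where
  field
    ∣𝒜∣       : ℕ
    atomAt    : Fin ∣𝒜∣ → Atom S n
    distinct  : Injective _≡_ _≡_ atomAt
    clauses   : List (Clause (Fin ∣𝒜∣))
    occurs    : ∀ a → Any (Any (λ ℓ → ℓ ≡ pos a ⊎ ℓ ≡ neg a)) clauses

  𝒜 : Set
  𝒜 = Fin ∣𝒜∣

  literal : Literal 𝒜 → Formula S n
  literal (pos a) = atom (atomAt a)
  literal (neg a) = ¬′ atom (atomAt a)

  disjunction conjunction : List (Literal 𝒜) → Formula S n
  disjunction L = ⋁ (map literal L)
  conjunction K = ⋀ (map literal K)

  formula : Formula S n
  formula = ⋀ (map disjunction clauses)

open CNF public

module _ {V W : Set} (f : V → W) where

  liftLiteral : Literal V → Literal W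
  liftLiteral (pos v) = pos (f v)
  liftLiteral (neg v) = neg (f v)

  lift : List (Literal V) → List (Literal W)
  lift = map liftLiteral

------------------------------------------------------------------------
-- Conflicts.  The argument K is the set of literals written ¬L
-- informally; the corresponding valid clause is L = map ~_ K.

module _ {S : Signature} (𝒯 : Theory S) {n : ℕ} (φ : CNF S n) where

  Conflict : List (Literal (𝒜 φ)) → Set₁
  Conflict K = Unsatisfiable 𝒯 (conjunction φ K)

  MinimalConflict : List (Literal (𝒜 φ)) → Set₁
  MinimalConflict K =
    Conflict K ×
    (∀ K′ → K′ ⊆ K → ¬ (K ⊆ K′) → Satisfiable 𝒯 (conjunction φ K′))

module _ {S : Signature} (𝒯 : Theory S) {n : ℕ} (φ : CNF S n)
         {X : Set} (𝔹 : 𝒜 φ → X) where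

  abstraction : List (Clause X)
  abstraction = map (lift 𝔹) (clauses φ)

  record Critical (M : Assignment X) : Set₁ where
    field
      satisfies : All (M ⊨ᶜ_) abstraction
      conflict  : List (Literal (𝒜 φ))
      minimal   : MinimalConflict 𝒯 φ conflict
      contained : lift 𝔹 conflict ⊑ M
      unique    : ∀ K → MinimalConflict 𝒯 φ K → lift 𝔹 K ⊑ M →
                  K ∼[ set ] conflict

  record CriticalSet (q : ℕ) : Set₁ where
    field
      member    : Fin q → Assignment X
      injective : Injective _≡_ _≋_ member
      critical  : ∀ i → Critical (member i)

  NonInterfering : ∀ {q} → CriticalSet q → Set
  NonInterfering Q = ∀ i j → ¬ (member i ≋ member j) →
                     ¬ (lift 𝔹 (Critical.conflict (critical i)) ⊑ member j)
    where open CriticalSet Q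

  ----------------------------------------------------------------------
  -- Proofs

  -- E = (C ∖ {ℓ}) ∪ (D ∖ {~ ℓ}) as sets.
  record Resolvent (ℓ : Literal X) (C D E : Clause X) : Set where
    field
      ℓ∈C  : ℓ ∈ C
      ~ℓ∈D : (~ ℓ) ∈ D
      union : ∀ x → x ∈ E ⇔ ((x ∈ C × x ≢ ℓ) ⊎ (x ∈ D × x ≢ ~ ℓ))

  -- Sequences of clauses, most recent clause first.
  data Derivation : List (Clause X) → Set₁ where
    start   : Derivation (reverse abstraction)
    resolve : ∀ {Γ} → Derivation Γ →
              (i j : Fin (length Γ)) → i ≢ j →
              ∀ ℓ {C} → Resolvent ℓ (lookup Γ i) (lookup Γ j) C →
              Derivation (C ∷ Γ)
    𝒯-learn : ∀ {Γ} → Derivation Γ →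
              ∀ L → Valid 𝒯 (disjunction φ L) →
              Derivation (lift 𝔹 L ∷ Γ)

  #𝒯-learn : ∀ {Γ} → Derivation Γ → ℕ
  #𝒯-learn start                   = zero
  #𝒯-learn (resolve d _ _ _ _ _)   = #𝒯-learn d
  #𝒯-learn (𝒯-learn d _ _)         = suc (#𝒯-learn d)

  FixedAlphabetProof : List (Clause X) → Set₁
  FixedAlphabetProof Γ = Derivation (□ ∷ Γ)

{-# OPTIONS --safe #-}

-- Resolution preserves the truth of clauses under an assignment, so a proof of □
-- must, for every M in Q, 𝒯-learn a clause Lᴮ that is false under M.  Then ¬L is a
-- 𝒯-conflict contained in M, and it includes a minimal one, which can only be the
-- minimal conflict of M.  Were the same L chosen for two members of Q, the minimal
-- conflict of the first would be contained in the second.  So the choice of L is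
-- injective.

module Submission where

open import Defs
open import Data.Fin using (Fin; zero; suc)
open import Data.Fin.Properties using (injective⇒≤) renaming (_≟_ to _≟ᶠ_)
open import Data.List using (List; []; _∷_; map; filter; length)
open import Data.List.Membership.Propositional using (_∈_; _∉_; lose; find)
open import Data.List.Membership.Propositional.Properties using (∈-filter⁺; ∈-lookup)
open import Data.List.Properties using (filter-notAll)
open import Data.List.Relation.Binary.Subset.Propositional using (_⊆_)
open import Data.List.Relation.Binary.Subset.Propositional.Properties
  using (⊆-refl; ⊆-trans; filter-⊆; All-resp-⊇; map⁺)
open import Data.List.Relation.Unary.All as All using (All; []; _∷_)
open import Data.List.Relation.Unary.All.Properties using (¬All⇒Any¬)
open import Data.List.Relation.Unary.Any as Any using (here; there)
open import Data.List.Relation.Unary.Any.Properties using (reverse⁻)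
open import Data.Nat using (ℕ; _≤_; _<_)
open import Data.Nat.Induction using (Acc; acc; <-wellFounded)
open import Data.Product using (∃-syntax; _×_; _,_; proj₁; proj₂)
open import Data.Sum using (_⊎_; inj₁; inj₂)
import Data.Sum as Sum
open import Function using (Injective; Equivalence; id; _∘_; _∘′_)
import Level
open import Relation.Binary.Definitions using (DecidableEquality)
open import Relation.Binary.PropositionalEquality using (_≡_; refl; sym; cong; subst)
open import Relation.Nullary using (¬_; no; ¬?)
open import Relation.Nullary.Decidable using (decidable-stable; map′)
open import Relation.Nullary.Negation using (¬¬-Monad)
import Data.List.Membership.DecPropositional as DecMembership

module _ {V : Set} (_≟_ : DecidableEquality V) where

  ≟-literal : DecidableEquality (Literal V)
  ≟-literal (pos v) (pos w) = map′ (cong pos) (λ { refl → refl }) (v ≟ w)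
  ≟-literal (pos v) (neg w) = no λ ()
  ≟-literal (neg v) (pos w) = no λ ()
  ≟-literal (neg v) (neg w) = map′ (cong neg) (λ { refl → refl }) (v ≟ w)

module _ {A : Set} (_≟_ : DecidableEquality A) where

  open DecMembership _≟_ using (_∈?_)

  remove : A → List A → List A
  remove x = filter (λ y → ¬? (y ≟ x))

  remove-⊆ : ∀ x xs → remove x xs ⊆ xs
  remove-⊆ x = filter-⊆ (λ y → ¬? (y ≟ x))

  length-remove : ∀ {x xs} → x ∈ xs → length (remove x xs) < length xs
  length-remove {x} {xs} x∈xs =
    filter-notAll (λ y → ¬? (y ≟ x)) xs (Any.map (λ x≡y y≢x → y≢x (sym x≡y)) x∈xs)

  ⊆-remove : ∀ {x xs ys} → ys ⊆ xs → x ∉ ys → ys ⊆ remove x xs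
  ⊆-remove {x} ys⊆xs x∉ys y∈ys =
    ∈-filter⁺ (λ y → ¬? (y ≟ x)) (ys⊆xs y∈ys) (λ { refl → x∉ys y∈ys })

  ⊈⇒∃∉ : ∀ {xs ys : List A} → ¬ (xs ⊆ ys) → ∃[ x ] (x ∈ xs × x ∉ ys)
  ⊈⇒∃∉ {xs} {ys} xs⊈ys =
    find (¬All⇒Any¬ (_∈? ys) xs (λ all → xs⊈ys (All.lookup all)))

module _ {X : Set} (M : Assignment X) where

  literal-total : ∀ ℓ → literals M ℓ ⊎ literals M (~ ℓ)
  literal-total (pos v) = total M v
  literal-total (neg v) = Sum.swap (total M v)

  literal-consistent : ∀ ℓ → literals M ℓ → ¬ literals M (~ ℓ)
  literal-consistent (pos v) p q = consistent M v (p , q)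
  literal-consistent (neg v) p q = consistent M v (q , p)

  module _ {V : Set} (f : V → X) where

    ~-lift : ∀ ℓ → literals M (~ liftLiteral f ℓ) → literals M (liftLiteral f (~ ℓ))
    ~-lift (pos v) = id
    ~-lift (neg v) = id

    -- Totality of M decides the literals one by one, so the alternative is available constructively
    -- although `literals M` is an arbitrary predicate.
    true-or-falsified : ∀ L → M ⊨ᶜ lift f L ⊎ lift f (map ~_ L) ⊑ M
    true-or-falsified []      = inj₂ []
    true-or-falsified (ℓ ∷ L) with literal-total (liftLiteral f ℓ)
    ... | inj₁ true  = inj₁ (here true)
    ... | inj₂ false = Sum.map there (~-lift ℓ false ∷_) (true-or-falsified L)

module _ {S : Signature} {n : ℕ} (φ : CNF S n) (𝔐 : Structure S)
         (ρ : Valuation 𝔐 n) where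

  private
    _holds : Formula S n → Set
    A holds = Holds 𝔐 A ρ

  -- A ∧ B is encoded as ¬ (A ⇒ ¬ B), so unfolding it yields a conjunct under a double negation;
  -- `conjunction-intro` accepts its inputs in just this form.
  conjunction-elim : ∀ {K} → conjunction φ K holds →
                     ∀ {ℓ} → ℓ ∈ K → ¬ ¬ (literal φ ℓ holds)
  conjunction-elim h (here refl) ¬ℓ = h (λ hℓ _ → ¬ℓ hℓ)
  conjunction-elim h (there ℓ∈K) ¬ℓ = h (λ _ hK → conjunction-elim hK ℓ∈K ¬ℓ)

  conjunction-intro : ∀ {K} → All (λ ℓ → ¬ ¬ (literal φ ℓ holds)) K →
                      conjunction φ K holds
  conjunction-intro []         = id
  conjunction-intro (¬¬ℓ ∷ hs) k = ¬¬ℓ (λ hℓ → k hℓ (conjunction-intro hs))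

  conjunction-anti-mono : ∀ {K K′} → K′ ⊆ K →
                          conjunction φ K holds → conjunction φ K′ holds
  conjunction-anti-mono K′⊆K h =
    conjunction-intro (All.tabulate (λ ℓ∈K′ → conjunction-elim h (K′⊆K ℓ∈K′)))

  ~-refutes : ∀ ℓ → literal φ (~ ℓ) holds → ¬ (literal φ ℓ holds)
  ~-refutes (pos _) ¬a ha = ¬a ha
  ~-refutes (neg _) ha ¬a = ¬a ha

  -- With ℓ ∨ D encoded as ¬ ℓ ⇒ D, each refuted literal passes the truth of the disjunction on to
  -- its tail, until only `⊥′` is left.
  negation-refutes : ∀ L → disjunction φ L holds →
                     ¬ (conjunction φ (map ~_ L) holds)
  negation-refutes []      h _ = h
  negation-refutes (ℓ ∷ L) h k =
    k (λ h~ℓ → negation-refutes L (h (~-refutes ℓ h~ℓ)))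

module _ {S : Signature} (𝒯 : Theory S) {n : ℕ} (φ : CNF S n) where

  satisfiable-anti-mono : ∀ {K K′} → K′ ⊆ K →
                          Satisfiable 𝒯 (conjunction φ K) →
                          Satisfiable 𝒯 (conjunction φ K′)
  satisfiable-anti-mono K′⊆K (𝔐 , model , ρ , h) =
    𝔐 , model , ρ , conjunction-anti-mono φ 𝔐 ρ K′⊆K h

  valid⇒conflict : ∀ L → Valid 𝒯 (disjunction φ L) → Conflict 𝒯 φ (map ~_ L)
  valid⇒conflict L valid (𝔐 , model , ρ , h) =
    negation-refutes φ 𝔐 ρ L (valid 𝔐 model ρ) h

  private
    _≟ˡ_ : DecidableEquality (Literal (𝒜 φ))
    _≟ˡ_ = ≟-literal _≟ᶠ_

    infixl 6 _∖_
    _∖_ : List (Literal (𝒜 φ)) → Literal (𝒜 φ) → List (Literal (𝒜 φ))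
    K ∖ ℓ = remove _≟ˡ_ ℓ K

  -- A strict subset of K misses some ℓ of K and so lies within `K ∖ ℓ`. Minimality thus rests on
  -- finitely many satisfiability claims.
  minimal-if-removals-satisfiable :
    ∀ {K} → Conflict 𝒯 φ K →
    All (λ ℓ → Satisfiable 𝒯 (conjunction φ (K ∖ ℓ))) K →
    MinimalConflict 𝒯 φ K
  minimal-if-removals-satisfiable conflict sats = conflict , λ K′ K′⊆K K⊈K′ →
    let ℓ , ℓ∈K , ℓ∉K′ = ⊈⇒∃∉ _≟ˡ_ K⊈K′
    in satisfiable-anti-mono (⊆-remove _≟ˡ_ K′⊆K ℓ∉K′) (All.lookup sats ℓ∈K)

  -- Satisfiability is undecidable, so a minimal conflict exists only classically.
  minimal-subconflict : ∀ {K} → Conflict 𝒯 φ K →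
                        ¬ ¬ (∃[ K′ ] (K′ ⊆ K × MinimalConflict 𝒯 φ K′))
  minimal-subconflict {K} = go K (<-wellFounded (length K))
    where
    go : ∀ K → Acc _<_ (length K) → Conflict 𝒯 φ K →
         ¬ ¬ (∃[ K′ ] (K′ ⊆ K × MinimalConflict 𝒯 φ K′))
    go K (acc rec) conflict none =
      -- K is finite, so the double negations of the separate claims combine into one: all removals
      -- may be assumed satisfiable together.
      All.sequenceM (Level.suc Level.zero) ¬¬-Monad (All.tabulate removal-satisfiable)
        (λ sats → none (K , ⊆-refl , minimal-if-removals-satisfiable conflict sats))
      where
      removal-satisfiable : ∀ {ℓ} → ℓ ∈ K → ¬ ¬ Satisfiable 𝒯 (conjunction φ (K ∖ ℓ))
      removal-satisfiable {ℓ} ℓ∈K unsat =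
        -- An unsatisfiable `K ∖ ℓ` is a shorter conflict, and a minimal conflict inside it also
        -- lies inside K, against `none`.
        go (K ∖ ℓ) (rec (length-remove _≟ˡ_ ℓ∈K)) unsat
          (λ (K′ , K′⊆ , minimal) →
            none (K′ , ⊆-trans K′⊆ (remove-⊆ _≟ˡ_ ℓ K) , minimal))

module _ {S : Signature} (𝒯 : Theory S) {n : ℕ} (φ : CNF S n)
         {X : Set} (𝔹 : 𝒜 φ → X) where

  -- Whichever of ℓ and `~ ℓ` is true under M, the premise from which the other one is deleted keeps
  -- its true literal.
  resolvent-sound : ∀ (M : Assignment X) {ℓ C D E} → Resolvent 𝒯 φ 𝔹 ℓ C D E →
                    M ⊨ᶜ C → M ⊨ᶜ D → M ⊨ᶜ E
  resolvent-sound M {ℓ} r M⊨C M⊨D with literal-total M ℓ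
  ... | inj₁ Mℓ =
    let y , y∈D , My = find M⊨D
    in lose (Equivalence.from (Resolvent.union r y)
              (inj₂ (y∈D , λ y≡~ℓ → literal-consistent M ℓ Mℓ (subst (literals M) y≡~ℓ My)))) My
  ... | inj₂ M~ℓ =
    let x , x∈C , Mx = find M⊨C
    in lose (Equivalence.from (Resolvent.union r x)
              (inj₁ (x∈C , λ x≡ℓ → literal-consistent M ℓ (subst (literals M) x≡ℓ Mx) M~ℓ))) Mx

  -- Indices run over the learning steps, most recent first, so that two steps learning the same
  -- clause stay distinct and an injection into the indices bounds their number.
  learnt : ∀ {Γ} (d : Derivation 𝒯 φ 𝔹 Γ) → Fin (#𝒯-learn 𝒯 φ 𝔹 d) → Clause (𝒜 φ)
  learnt (resolve d _ _ _ _ _) k       = learnt d k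
  learnt (𝒯-learn d L _)       zero    = L
  learnt (𝒯-learn d L _)       (suc k) = learnt d k

  learnt-valid : ∀ {Γ} (d : Derivation 𝒯 φ 𝔹 Γ) k →
                 Valid 𝒯 (disjunction φ (learnt d k))
  learnt-valid (resolve d _ _ _ _ _) k       = learnt-valid d k
  learnt-valid (𝒯-learn d L valid)   zero    = valid
  learnt-valid (𝒯-learn d L _)       (suc k) = learnt-valid d k

  -- Falsity is put positively, as containment of the negated literals: the form in which `Critical`
  -- speaks of conflicts.
  Falsifies : ∀ {Γ} → Assignment X → (d : Derivation 𝒯 φ 𝔹 Γ) →
              Fin (#𝒯-learn 𝒯 φ 𝔹 d) → Set
  Falsifies M d k = lift 𝔹 (map ~_ (learnt d k)) ⊑ M

  -- Induction along the derivation; only a learning step can introduce the second alternative,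
  -- which then persists.
  all-true-or-learnt-falsified :
    (M : Assignment X) → All (M ⊨ᶜ_) (abstraction 𝒯 φ 𝔹) →
    ∀ {Γ} (d : Derivation 𝒯 φ 𝔹 Γ) → All (M ⊨ᶜ_) Γ ⊎ ∃[ k ] Falsifies M d k
  all-true-or-learnt-falsified M M⊨φ start = inj₁ (All-resp-⊇ reverse⁻ M⊨φ)
  all-true-or-learnt-falsified M M⊨φ (resolve d i j _ _ r) =
    Sum.map₁ (λ M⊨Γ → resolvent-sound M r (All.lookup M⊨Γ (∈-lookup i))
                                          (All.lookup M⊨Γ (∈-lookup j)) ∷ M⊨Γ)
      (all-true-or-learnt-falsified M M⊨φ d)
  all-true-or-learnt-falsified M M⊨φ (𝒯-learn d L _)
    with all-true-or-learnt-falsified M M⊨φ d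
  ... | inj₂ (k , false) = inj₂ (suc k , false)
  ... | inj₁ M⊨Γ         =
    Sum.map (_∷ M⊨Γ) (zero ,_) (true-or-falsified M 𝔹 L)

  refutation-learns-falsified :
    (M : Assignment X) → All (M ⊨ᶜ_) (abstraction 𝒯 φ 𝔹) →
    ∀ {Γ} (π : FixedAlphabetProof 𝒯 φ 𝔹 Γ) → ∃[ k ] Falsifies M π k
  refutation-learns-falsified M M⊨φ π with all-true-or-learnt-falsified M M⊨φ π
  ... | inj₁ (() ∷ _)
  ... | inj₂ falsified = falsified

  lift-anti-mono : ∀ (M : Assignment X) {K K′} → K′ ⊆ K →
                   lift 𝔹 K ⊑ M → lift 𝔹 K′ ⊑ M
  lift-anti-mono M K′⊆K = All-resp-⊇ (map⁺ (liftLiteral 𝔹) K′⊆K)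

  -- A minimal conflict inside K is contained in M as well, so by uniqueness it has the literals of
  -- the conflict of M. The double negation comes from `minimal-subconflict`.
  critical-conflict-⊆ : ∀ {M} (c : Critical 𝒯 φ 𝔹 M) {K} → Conflict 𝒯 φ K →
                        lift 𝔹 K ⊑ M → ¬ ¬ (Critical.conflict c ⊆ K)
  critical-conflict-⊆ {M} c unsat K⊑M ⊈K =
    minimal-subconflict 𝒯 φ unsat λ (K′ , K′⊆K , minimal) →
      ⊈K (K′⊆K ∘′ Equivalence.from
           (Critical.unique c K′ minimal (lift-anti-mono M K′⊆K K⊑M)))

theorem2p2 : (S : Signature) (𝒯 : Theory S) (n : ℕ) (φ : CNF S n)
    (X : Set) (𝔹 : 𝒜 φ → X) → Injective _≡_ _≡_ 𝔹 →
    Unsatisfiable 𝒯 (formula φ) →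
    (q : ℕ) (Q : CriticalSet 𝒯 φ 𝔹 q) → NonInterfering 𝒯 φ 𝔹 Q →
    (Γ : List (Clause X)) (π : FixedAlphabetProof 𝒯 φ 𝔹 Γ) →
    q ≤ #𝒯-learn 𝒯 φ 𝔹 π
theorem2p2 S 𝒯 n φ X 𝔹 _ _ q Q nonInterfering Γ π = injective⇒≤ index-injective
  where
  open CriticalSet Q

  falsified : ∀ i → ∃[ k ] Falsifies 𝒯 φ 𝔹 (member i) π k
  falsified i =
    refutation-learns-falsified 𝒯 φ 𝔹 (member i) (Critical.satisfies (critical i)) π

  index : Fin q → Fin (#𝒯-learn 𝒯 φ 𝔹 π)
  index = proj₁ ∘ falsified

  index-injective : Injective _≡_ _≡_ index
  -- Equality in `Fin q` is decidable, hence stable, so a contradiction from i ≢ j is enough and the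
  -- double negation above does no harm.
  index-injective {i} {j} same = decidable-stable (i ≟ᶠ j) λ i≢j →
    critical-conflict-⊆ 𝒯 φ 𝔹 (critical i)
      (valid⇒conflict 𝒯 φ (learnt 𝒯 φ 𝔹 π (index i)) (learnt-valid 𝒯 φ 𝔹 π (index i)))
      (proj₂ (falsified i))
      -- By `same`, `member j` falsifies the clause learnt at `index i` too, so it contains every
      -- subset of that clause's negation, the minimal conflict of `member i` among them.
      λ conflict⊆ → nonInterfering i j (i≢j ∘ injective)
        (lift-anti-mono 𝒯 φ 𝔹 (member j) conflict⊆
          (subst (Falsifies 𝒯 φ 𝔹 (member j) π) (sym same) (proj₂ (falsified j))))
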